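{- There exist two non-isomorphic MIF$(4)$'s each having exactly $42$ blocks.
   Context: A family is a non-empty set of non-empty finite sets, called its blocks. The point set of a family $\mathcal{G}$ is $P_{\mathcal{G}}=\bigcup_{B\in\mathcal{G}}B$. A family is uniform if all its blocks have the same size, denoted $\mathrm{k}(\mathcal{G})$. A blocking set of $\mathcal{G}$ is a set meeting every block of $\mathcal{G}$. If $\mathcal{G}$ has a finite blocking set, $\mathrm{tr}(\mathcal{G})$ is the smallest size of a blocking set, a transversal is a blocking set of size $\mathrm{tr}(\mathcal{G})$, and $\mathcal{G}^{\top}$ is the family of all transversals of $\mathcal{G}$; otherwise $\mathrm{tr}(\mathcal{G})=\infty$. A MIF$(k)$ is a uniform family $\mathcal{F}$ with $\mathrm{k}(\mathcal{F})=k$, $\mathrm{tr}(\mathcal{F})<\infty$ and $\mathcal{F}=\mathcal{F}^{\top}$. Families $\mathcal{G}$ and $\mathcal{H}$ are isomorphic if there is a bijection $\phi:P_{\mathcal{G}}\to P_{\mathcal{H}}$ such that $\phi(B)\in\mathcal{H}$ if and only if $B\in\mathcal{G}$. -}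

module Defs where

open import Data.Fin.Base using (Fin)
open import Data.List.Base using (List; length; map)
open import Data.List.Relation.Binary.BagAndSetEquality
  using (_∼[_]_; set; [_]-Equality)
import Data.List.Membership.Propositional as List
open import Data.List.Relation.Unary.Unique.Setoid using (Unique)
import Data.List.Relation.Unary.Unique.Setoid.Properties as Unique
open import Data.Nat.Base using (ℕ; _≤_; _<_)
open import Data.Product.Base using (Σ; ∃; _×_; proj₁; proj₂)
open import Function.Base using (_∘_)
open import Function.Bundles using (Injection; Bijection; _⇔_)
import Function.Construct.Composition as Compose
open import Level using (0ℓ)
open import Relation.Binary.Bundles using (Setoid)
import Relation.Binary.Construct.On as On
open import Relation.Binary.PropositionalEquality.Core using (_≡_)
open import Relation.Binary.PropositionalEquality.Properties using (setoid)
open import Relation.Unary using (Pred; _≐_)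

-- A finite set is listed without repetition; the order of the listing is
-- forgotten by the equality _≋_ below.  The carrier is a setoid because the
-- point set of a family is one.
record FinSet (S : Setoid 0ℓ 0ℓ) : Set where
  constructor finSet
  field
    elements : List (Setoid.Carrier S)
    unique   : Unique S elements

open FinSet public

∣_∣ : ∀ {S} → FinSet S → ℕ
∣ B ∣ = length (elements B)

image : ∀ {S T} → Injection S T → FinSet S → FinSet T
image {S} {T} f B = finSet (map to (elements B)) (Unique.map⁺ S T injective (unique B))
  where open Injection f

FinSubset : Set → Set
FinSubset A = FinSet (setoid A)

module _ {A : Set} where

  infix 4 _∈_ _≋_

  _∈_ : A → FinSubset A → Set
  x ∈ B = x List.∈ elements B

  _≋_ : FinSubset A → FinSubset A → Set
  B ≋ C = elements B ∼[ set ] elements C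

-- The universe A may contain points lying in no block.
record Family (A : Set) : Set₁ where
  field
    IsBlock        : Pred (FinSubset A) 0ℓ
    respects-≋     : ∀ {B C} → B ≋ C → IsBlock B → IsBlock C
    nonEmpty       : ∃ IsBlock
    blocksNonEmpty : ∀ {B} → IsBlock B → 0 < ∣ B ∣

open Family public

module _ {A : Set} (F : Family A) where

  InPointSet : Pred A 0ℓ
  InPointSet x = ∃ λ B → IsBlock F B × x ∈ B

  -- Points are compared in A, irrespective of the block witnessing them.
  PointSet : Setoid 0ℓ 0ℓ
  PointSet = On.setoid {B = Σ A InPointSet} (setoid A) proj₁

  inclusion : Injection PointSet (setoid A)
  inclusion = record { to = proj₁ ; cong = λ eq → eq ; injective = λ eq → eq }

  BlockSet : Setoid 0ℓ 0ℓ
  BlockSet = On.setoid {B = Σ (FinSubset A) (IsBlock F)} ([ set ]-Equality A) (elements ∘ proj₁)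

  HasBlockCount : ℕ → Set
  HasBlockCount m = Bijection (setoid (Fin m)) BlockSet

  UniformOfSize : ℕ → Set
  UniformOfSize k = ∀ {B} → IsBlock F B → ∣ B ∣ ≡ k

  IsBlockingSet : Pred A 0ℓ → Set
  IsBlockingSet S = ∀ {B} → IsBlock F B → ∃ λ x → x ∈ B × S x

  -- The set underlying a finite set C is the predicate (_∈ C).
  HasFiniteBlockingSet : Set
  HasFiniteBlockingSet = ∃ λ (C : FinSubset A) → IsBlockingSet (_∈ C)

  -- A least element need not be computable from HasFiniteBlockingSet, so
  -- "tr(F) = t" is a relation between F and t.
  IsTr : ℕ → Set
  IsTr t = (∃ λ (C : FinSubset A) → IsBlockingSet (_∈ C) × ∣ C ∣ ≡ t)
         × (∀ (C : FinSubset A) → IsBlockingSet (_∈ C) → t ≤ ∣ C ∣)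

  IsTransversal : Pred (FinSubset A) 0ℓ
  IsTransversal C = IsBlockingSet (_∈ C) × IsTr ∣ C ∣

  record IsMIF (k : ℕ) : Set where
    field
      uniform             : UniformOfSize k
      finiteBlockingSet   : HasFiniteBlockingSet
      blocks≐transversals : IsBlock F ≐ IsTransversal

-- Sets of points range over the finite subsets of the point set of G, and are
-- carried to the universes A and A′ by image.
record Isomorphic {A A′ : Set} (G : Family A) (H : Family A′) : Set where
  field
    φ : Bijection (PointSet G) (PointSet H)

  φ-inclusion : Injection (PointSet G) (setoid A′)
  φ-inclusion = Compose.injection (Bijection.injection φ) (inclusion H)

  field
    preservesBlocks : ∀ (B : FinSet (PointSet G)) →
      IsBlock H (image φ-inclusion B) ⇔ IsBlock G (image (inclusion G) B)

{-# OPTIONS --safe #-}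
module Submission where

-- Both families live on ten points and were found by computer search.  A set of
-- at most four points meeting every block contains a point of the first block,
-- a point of the first block not yet met, and so on, so a search tree with at
-- most 4⁴ leaves shows that it is a block; hence tr = 4 and the transversals are
-- exactly the blocks.  The families differ in that any two points of the first
-- lie on at least two common blocks, whereas {6,7,8,9} is the only block of the
-- second through 6 and 7.

open import Defs
open import Data.Fin using (Fin; #_)
import Data.Fin.Literals as FinLiterals
open import Data.Fin.Properties using (_≟_; all?)
open import Data.List.Base
  using (List; []; _∷_; [_]; _++_; cartesianProductWith; concatMap; filter; foldr; length; lookup; map)
open import Data.List.Membership.Propositional as List using (mapWith∈)
open import Data.List.Membership.Propositional.Properties
  using (∈-∃++; ∈-filter⁻; ∈-lookup; ∈-map⁺; ∈-map⁻; mapWith∈-id; map-mapWith∈)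
open import Data.List.Membership.Propositional.Properties.WithK using (unique∧set⇒bag)
open import Data.List.Properties using (++-identityʳ)
open import Data.List.Relation.Binary.BagAndSetEquality
  using (_∼[_]_; set; bag-=⇒; ↭⇒∼bag; ∼bag⇒↭; [_]-Equality)
open import Data.List.Relation.Binary.Permutation.Propositional using (_↭_; ↭-sym; ↭-trans)
open import Data.List.Relation.Binary.Permutation.Propositional.Properties
  using (↭-length; ∈-resp-↭; shift; ++⁺ʳ)
open import Data.List.Relation.Unary.All as All using (All)
open import Data.List.Relation.Unary.AllPairs using (allPairs?)
import Data.List.Relation.Unary.AllPairs.Properties as AllPairs
open import Data.List.Relation.Unary.Any as Any using (Any)
open import Data.List.Relation.Unary.Any.Properties using (lookup-index)
open import Data.List.Relation.Unary.Unique.Propositional using (Unique)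
open import Data.Nat.Base using (ℕ; zero; suc; z≤n; s≤s; _≤_; _<_)
import Data.Nat.Properties as ℕ
open import Data.Product.Base using (Σ-syntax; ∃₂; _×_; _,_; proj₁; proj₂)
open import Data.Sum.Base using (inj₁; inj₂)
open import Data.Unit.Base using (⊤; tt)
open import Function.Base using (_∘_)
open import Function.Bundles using (Bijection; Equivalence; mk⇔)
open import Relation.Binary.Bundles using (Setoid)
open import Relation.Binary.PropositionalEquality.Core using (_≡_; refl; sym; trans; cong; subst)
open import Relation.Nullary.Decidable
  using (Dec; yes; no; from-yes; map′; ¬?; _×-dec_; _→-dec_)
open import Relation.Nullary.Negation.Core using (¬_; contradiction)
open import Relation.Unary using (Decidable)

private
  variable
    A A′ : Set

module ∼ {A : Set} = Setoid ([ set ]-Equality A)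

-- Without repetitions, equality as sets upgrades to equality as bags, that is, to a permutation.
∼⇒length≡ : ∀ {xs ys : List A} → Unique xs → Unique ys → xs ∼[ set ] ys → length xs ≡ length ys
∼⇒length≡ xs! ys! xs∼ys = ↭-length (∼bag⇒↭ (unique∧set⇒bag xs! ys! xs∼ys))

-- Maximal intersecting families

-- A blocking set of size at most `k` is a block and so has size exactly `k`; hence `k` is the
-- minimum, and every block attains it. Conversely, comparison with `B₀` bounds a transversal by
-- `k`, so it is a block.
mif : ∀ {k} (F : Family A) → UniformOfSize F k →
      (∀ {B} → IsBlock F B → IsBlockingSet F (_∈ B)) →
      (∀ C → IsBlockingSet F (_∈ C) → ∣ C ∣ ≤ k → IsBlock F C) →
      IsMIF F k
mif {k = k} F uniform intersecting closed = record
  { uniform             = uniform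
  ; finiteBlockingSet   = B₀ , intersecting isB₀
  ; blocks≐transversals =
      (λ {B} isB → intersecting isB , subst (IsTr F) (sym (uniform isB)) tr≡k) ,
      (λ {C} (blocking , _ , least) →
        closed C blocking
          (ℕ.≤-trans (least B₀ (intersecting isB₀)) (ℕ.≤-reflexive (uniform isB₀))))
  }
  where
  B₀   = proj₁ (nonEmpty F)
  isB₀ = proj₂ (nonEmpty F)

  k≤ : ∀ C → IsBlockingSet F (_∈ C) → k ≤ ∣ C ∣
  k≤ C blocking with ℕ.≤-total k ∣ C ∣
  ... | inj₁ k≤C = k≤C
  ... | inj₂ C≤k = ℕ.≤-reflexive (sym (uniform (closed C blocking C≤k)))

  tr≡k : IsTr F k
  tr≡k = (B₀ , intersecting isB₀ , uniform isB₀) , k≤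

-- Two blocks through a given pair of points

-- The case `x ≡ y` is allowed, which keeps quantification over all pairs free of side conditions.
DoublyJoined : Family A → A → A → Set
DoublyJoined F x y = ∃₂ λ B C →
  IsBlock F B × IsBlock F C × ¬ (B ≋ C) × (x ∈ B × y ∈ B) × (x ∈ C × y ∈ C)

module _ {G : Family A} {H : Family A′} (iso : Isomorphic G H) where

  open Isomorphic iso
  open Bijection φ using (to; injective) renaming (cong to to-cong)

  -- `preservesBlocks` speaks of finite subsets of the point set, so each element of `B` is paired
  -- with `B` itself as the witness that it is a point.
  points : ∀ B → IsBlock G B → List (Setoid.Carrier (PointSet G))
  points B isB = mapWith∈ (elements B) λ {x} x∈B → x , B , isB , x∈B

  map-proj₁-points : ∀ B isB → map proj₁ (points B isB) ≡ elements B
  map-proj₁-points B isB = trans (map-mapWith∈ (elements B) _ proj₁) (mapWith∈-id (elements B))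

  lift : ∀ B → IsBlock G B → FinSet (PointSet G)
  lift B isB = finSet (points B isB)
    (AllPairs.map⁻ (subst Unique (sym (map-proj₁-points B isB)) (unique B)))

  pushforward : ∀ B → IsBlock G B → FinSubset A′
  pushforward B isB = image φ-inclusion (lift B isB)

  pushforward-isBlock : ∀ B isB → IsBlock H (pushforward B isB)
  pushforward-isBlock B isB = Equivalence.from (preservesBlocks (lift B isB))
    (respects-≋ G (∼.reflexive (sym (map-proj₁-points B isB))) isB)

  ∈-pushforward⁺ : ∀ {B} isB p → proj₁ p ∈ B → proj₁ (to p) ∈ pushforward B isB
  ∈-pushforward⁺ {B} isB p p∈B
    -- `q` is the same point as `p`, perhaps with another witnessing block; `to` respects this
    -- equality.
    with q , q∈ , p≡q ← ∈-map⁻ proj₁ (subst (proj₁ p List.∈_) (sym (map-proj₁-points B isB)) p∈B)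
    = subst (List._∈ elements (pushforward B isB)) (to-cong {q} {p} (sym p≡q)) (∈-map⁺ _ q∈)

  ∈-pushforward⁻ : ∀ {B} isB p → proj₁ (to p) ∈ pushforward B isB → proj₁ p ∈ B
  ∈-pushforward⁻ {B} isB p p∈
    with q , q∈ , p≡q ← ∈-map⁻ _ p∈
    = subst (_∈ B) (sym (injective {p} {q} p≡q))
        (subst (proj₁ q List.∈_) (map-proj₁-points B isB) (∈-map⁺ proj₁ q∈))

  -- Injectivity of `φ` lets membership be pulled back, so distinct blocks keep distinct images.
  pushforward-injective : ∀ {B C} isB isC → pushforward B isB ≋ pushforward C isC → B ≋ C
  pushforward-injective {B} {C} isB isC eq {x} = mk⇔
    (λ x∈B → let p = x , B , isB , x∈B in
      ∈-pushforward⁻ isC p (Equivalence.to eq (∈-pushforward⁺ isB p x∈B)))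
    (λ x∈C → let p = x , C , isC , x∈C in
      ∈-pushforward⁻ isB p (Equivalence.from eq (∈-pushforward⁺ isC p x∈C)))

  DoublyJoined-resp-iso : ∀ p q → DoublyJoined G (proj₁ p) (proj₁ q) →
                          DoublyJoined H (proj₁ (to p)) (proj₁ (to q))
  DoublyJoined-resp-iso p q (B , C , isB , isC , B≉C , (p∈B , q∈B) , (p∈C , q∈C)) =
    pushforward B isB , pushforward C isC ,
    pushforward-isBlock B isB , pushforward-isBlock C isC ,
    B≉C ∘ pushforward-injective isB isC ,
    (∈-pushforward⁺ isB p p∈B , ∈-pushforward⁺ isB q q∈B) ,
    (∈-pushforward⁺ isC p p∈C , ∈-pushforward⁺ isC q q∈C)

  -- Surjectivity of `φ` supplies preimages, though only for points of `H`; these are doubly joined,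
  -- and `φ` transports this.
  allDoublyJoined⇒DoublyJoined : (∀ x y → DoublyJoined G x y) →
    ∀ {x y} → InPointSet H x → InPointSet H y → DoublyJoined H x y
  allDoublyJoined⇒DoublyJoined joined {x} {y} x∈H y∈H
    with p , p↦x ← Bijection.surjective φ (x , x∈H)
       | q , q↦y ← Bijection.surjective φ (y , y∈H)
    with refl ← p↦x {p} refl | refl ← q↦y {q} refl
    = DoublyJoined-resp-iso p q (joined (proj₁ p) (proj₁ q))

-- Families given by a list of blocks

module _ {n : ℕ} where

  infix 4 _∈?_ _∼?_

  _∈?_ : ∀ (x : Fin n) xs → Dec (x List.∈ xs)
  x ∈? xs = Any.any? (x ≟_) xs

  _∼?_ : ∀ (xs ys : List (Fin n)) → Dec (xs ∼[ set ] ys)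
  xs ∼? ys = map′
    (λ (xs⊆ys , ys⊆xs) → mk⇔ (All.lookup xs⊆ys) (All.lookup ys⊆xs))
    (λ xs∼ys → All.tabulate (Equivalence.to xs∼ys) , All.tabulate (Equivalence.from xs∼ys))
    (All.all? (_∈? ys) xs ×-dec All.all? (_∈? xs) ys)

  unique? : ∀ (xs : List (Fin n)) → Dec (Unique xs)
  unique? = allPairs? λ x y → ¬? (x ≟ y)

  MeetsAll : List (List (Fin n)) → List (Fin n) → Set
  MeetsAll bs xs = All (Any (List._∈ xs)) bs

  meetsAll? : ∀ bs → Decidable (MeetsAll bs)
  meetsAll? bs xs = All.all? (Any.any? (_∈? xs)) bs

module _ {n : ℕ} (bs : List (List (Fin n))) where

  Listed : List (Fin n) → Set
  Listed xs = Any (xs ∼[ set ]_) bs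

  listed? : Decidable Listed
  listed? xs = Any.any? (xs ∼?_) bs

  -- A derivation of Branching j rest acc certifies that acc ∪ xs is a listed
  -- block for every xs of size at most j meeting all of rest: such an xs
  -- contains a point x of the first member of rest, and x is moved to acc.
  data Branching : ℕ → List (List (Fin n)) → List (Fin n) → Set where
    complete : ∀ {acc} → Listed acc → Branching zero [] acc
    stuck    : ∀ {b rest acc} → Branching zero (b ∷ rest) acc
    branch   : ∀ {j b rest acc} →
               All (λ x → Branching j (filter (¬? ∘ (x ∈?_)) rest) (x ∷ acc)) b →
               Branching (suc j) (b ∷ rest) acc

  branching? : ∀ j rest acc → Dec (Branching j rest acc)
  branching? zero    []         acc = map′ complete (λ { (complete l) → l }) (listed? acc)
  branching? zero    (b ∷ rest) acc = yes stuck
  -- In a search from the empty `acc`, here `acc` already meets every block with fewer points than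
  -- the initial bound, so the search must fail.
  branching? (suc j) []         acc = no λ ()
  branching? (suc j) (b ∷ rest) acc = map′ branch (λ { (branch t) → t })
    (All.all? (λ x → branching? j (filter (¬? ∘ (x ∈?_)) rest) (x ∷ acc)) b)

  branching⇒listed : ∀ {j rest acc} → Branching j rest acc →
    ∀ xs → length xs ≤ j → MeetsAll rest xs → Listed (xs ++ acc)
  branching⇒listed (complete acc-listed) [] _ _ = acc-listed
  branching⇒listed stuck [] _ (b-met All.∷ _) =
    contradiction (proj₂ (List.find b-met)) λ ()
  branching⇒listed {suc j} {_ ∷ rest} {acc} (branch t) xs ∣xs∣≤ (b-met All.∷ rest-met)
    with x , x∈b , x∈xs ← List.find b-met
    with ys , zs , refl ← ∈-∃++ x∈xs
    = Any.map (∼.trans (bag-=⇒ (↭⇒∼bag move)))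
        (branching⇒listed (All.lookup t x∈b) (ys ++ zs)
          (ℕ.≤-pred (subst (_≤ suc j) (↭-length (shift x ys zs)) ∣xs∣≤))
          (All.tabulate still-met))
    where
    move : (ys ++ x ∷ zs) ++ acc ↭ (ys ++ zs) ++ x ∷ acc
    move = ↭-trans (++⁺ʳ acc (shift x ys zs)) (↭-sym (shift x (ys ++ zs) acc))

    -- Members containing `x` were filtered out, so a remaining one is met by a point of `xs` other
    -- than `x`, which survives the removal of `x`.
    still-met : ∀ {c} → c List.∈ filter (¬? ∘ (x ∈?_)) rest → Any (List._∈ (ys ++ zs)) c
    still-met c∈
      with c∈rest , x∉c ← ∈-filter⁻ (¬? ∘ (x ∈?_)) {xs = rest} c∈
      with y , y∈c , y∈xs ← List.find (All.lookup rest-met c∈rest)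
      with ∈-resp-↭ (shift x ys zs) y∈xs
    ... | Any.here refl   = contradiction y∈c x∉c
    ... | Any.there y∈rem = List.lose y∈c y∈rem

  -- All fields are decidable, so a concrete list can be certified by evaluation. Indices in
  -- `distinct` make the block count equal to the length of `bs`.
  record ListsMIF (k : ℕ) : Set where
    constructor listsMIF
    field
      inhabited    : Any (λ _ → ⊤) bs
      uniqueBlocks : All Unique bs
      uniform      : All (λ b → length b ≡ k) bs
      distinct     : ∀ i j → lookup bs i ∼[ set ] lookup bs j → i ≡ j
      intersecting : All (MeetsAll bs) bs
      closed       : Branching k bs []

  listsMIF? : ∀ k → Dec (ListsMIF k)
  listsMIF? k = map′
    (λ (a , b , c , d , e , f) → listsMIF a b c d e f)
    (λ (listsMIF a b c d e f) → a , b , c , d , e , f)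
    (Any.any? (λ _ → yes tt) bs
      ×-dec All.all? unique? bs
      ×-dec All.all? (λ b → length b ℕ.≟ k) bs
      ×-dec all? (λ i → all? λ j → (lookup bs i ∼? lookup bs j) →-dec (i ≟ j))
      ×-dec All.all? (meetsAll? bs) bs
      ×-dec branching? k bs [])

module _ {n k : ℕ} {bs : List (List (Fin n))} (mif! : ListsMIF bs (suc k)) where

  open ListsMIF mif!

  toBlock : ∀ {b} → b List.∈ bs → FinSubset (Fin n)
  toBlock {b} b∈bs = finSet b (All.lookup uniqueBlocks b∈bs)

  size : ∀ {B : FinSubset (Fin n)} → Listed bs (elements B) → ∣ B ∣ ≡ suc k
  size {B} listed with b , b∈bs , B∼b ← List.find listed =
    trans (∼⇒length≡ (unique B) (All.lookup uniqueBlocks b∈bs) B∼b) (All.lookup uniform b∈bs)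

  listed : ∀ {b} → b List.∈ bs → Listed bs b
  listed b∈bs = List.lose b∈bs ∼.refl

  family : Family (Fin n)
  family = record
    { IsBlock        = Listed bs ∘ elements
    ; respects-≋     = λ B≋C → Any.map (∼.trans (∼.sym B≋C))
    ; nonEmpty       = let _ , b∈bs , _ = List.find inhabited in toBlock b∈bs , listed b∈bs
    ; blocksNonEmpty = λ {B} isB → subst (0 <_) (sym (size {B} isB)) (s≤s z≤n)
    }

  meetsAll⇒blocking : ∀ {xs} → MeetsAll bs xs → IsBlockingSet family (List._∈ xs)
  meetsAll⇒blocking meets isB
    with b , b∈bs , B∼b ← List.find isB
    with x , x∈b , x∈xs ← List.find (All.lookup meets b∈bs)
    = x , Equivalence.from B∼b x∈b , x∈xs

  blocking⇒meetsAll : ∀ {xs} → IsBlockingSet family (List._∈ xs) → MeetsAll bs xs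
  blocking⇒meetsAll blocking = All.tabulate λ b∈bs →
    let _ , x∈b , x∈xs = blocking {toBlock b∈bs} (listed b∈bs) in List.lose x∈b x∈xs

  family-isMIF : IsMIF family (suc k)
  family-isMIF = mif family (λ {B} → size {B}) (λ {B} → intersect {B})
    -- `acc` starts empty, so the search yields `elements C ++ []`.
    (λ C blocking ∣C∣≤k → subst (Listed bs) (++-identityʳ (elements C))
      (branching⇒listed bs closed (elements C) ∣C∣≤k (blocking⇒meetsAll (λ {B} → blocking {B}))))
    where
    intersect : ∀ {B} → IsBlock family B → IsBlockingSet family (_∈ B)
    intersect isB {C} isC
      with b , b∈bs , B∼b ← List.find isB
      with x , x∈C , x∈b ← meetsAll⇒blocking (All.lookup intersecting b∈bs) {C} isC
      = x , x∈C , Equivalence.from B∼b x∈b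

  family-blockCount : HasBlockCount family (length bs)
  family-blockCount = record
    { to        = λ i → toBlock (∈-lookup i) , listed (∈-lookup i)
    ; cong      = λ { refl → ∼.refl }
    ; bijective = distinct _ _ ,
                  λ (_ , isB) → Any.index isB , λ { refl → ∼.sym (lookup-index isB) }
    }

  listed⇒inPointSet : ∀ {x} → Any (x List.∈_) bs → InPointSet family x
  listed⇒inPointSet x∈ with _ , b∈bs , x∈b ← List.find x∈ = toBlock b∈bs , listed b∈bs , x∈b

  family-doublyJoined : ∀ {x y} →
    Any (λ b → (x List.∈ b × y List.∈ b) ×
      Any (λ c → (x List.∈ c × y List.∈ c) × ¬ (b ∼[ set ] c)) bs) bs →
    DoublyJoined family x y
  family-doublyJoined b-any
    with _ , b∈bs , xy∈b , c-any ← List.find b-any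
    with _ , c∈bs , xy∈c , b≁c ← List.find c-any
    = toBlock b∈bs , toBlock c∈bs , listed b∈bs , listed c∈bs , b≁c , xy∈b , xy∈c

  -- Both blocks would equal `c`, hence each other.
  family-¬doublyJoined : ∀ {x y c} →
    All (λ b → x List.∈ b × y List.∈ b → b ∼[ set ] c) bs → ¬ DoublyJoined family x y
  family-¬doublyJoined {x} {y} {c} b∼c (B , C , isB , isC , B≁C , xy∈B , xy∈C) =
    B≁C (∼.trans (∼c {B} isB xy∈B) (∼.sym (∼c {C} isC xy∈C)))
    where
    ∼c : ∀ {B} → IsBlock family B → x ∈ B × y ∈ B → elements B ∼[ set ] c
    ∼c isB (x∈B , y∈B) with _ , b∈bs , B∼b ← List.find isB
      = ∼.trans B∼b (All.lookup b∼c b∈bs (Equivalence.to B∼b x∈B , Equivalence.to B∼b y∈B))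

-- The two families

-- The Cartesian product of a list of lists, so that one line of factors encodes a batch of blocks.
selections : List (List A) → List (List A)
selections = foldr (cartesianProductWith _∷_) [ [] ]

Point : Set
Point = Fin 10

module Blocks where

  open import Agda.Builtin.FromNat using (Number; fromNat)

  private
    instance
      finNumber : ∀ {n} → Number (Fin n)
      finNumber {n} = FinLiterals.number n

  -- The six blocks missing 0 (the last three lines) are Pᵢ ∪ {qᵢ, x} with x ∈ Pᵢ₊₁,
  -- for Pᵢ ∪ {qᵢ} = {1,2} ∪ {3}, {4,5} ∪ {6}, {7,8} ∪ {9} and i mod 3; the other
  -- 36 add 0 to the triples meeting these six.
  blocks₁ : List (List Point)
  blocks₁ = concatMap selections
    ( ([ 0 ] ∷ (1 ∷ 2 ∷ [ 3 ]) ∷ (4 ∷ 5 ∷ [ 6 ]) ∷ (7 ∷ 8 ∷ [ 9 ]) ∷ [])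
    ∷ ([ 0 ] ∷ [ 4 ] ∷ [ 5 ] ∷ (7 ∷ 8 ∷ [ 9 ]) ∷ [])
    ∷ ([ 0 ] ∷ [ 7 ] ∷ [ 8 ] ∷ (1 ∷ 2 ∷ [ 3 ]) ∷ [])
    ∷ ([ 0 ] ∷ [ 1 ] ∷ [ 2 ] ∷ (4 ∷ 5 ∷ [ 6 ]) ∷ [])
    ∷ ([ 1 ] ∷ [ 2 ] ∷ [ 3 ] ∷ (4 ∷ [ 5 ]) ∷ [])
    ∷ ([ 4 ] ∷ [ 5 ] ∷ [ 6 ] ∷ (7 ∷ [ 8 ]) ∷ [])
    ∷ ([ 7 ] ∷ [ 8 ] ∷ [ 9 ] ∷ (1 ∷ [ 2 ]) ∷ [])
    ∷ [])

  -- The first three lines give 36 blocks: two points of {0,1,2}, one of {3,4,5} and one of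
  -- {6,7,8,9}. The other lines add 3 + 2 + 1.
  blocks₂ : List (List Point)
  blocks₂ = concatMap selections
    ( ([ 0 ] ∷ [ 1 ] ∷ (3 ∷ 4 ∷ [ 5 ]) ∷ (6 ∷ 7 ∷ 8 ∷ [ 9 ]) ∷ [])
    ∷ ([ 0 ] ∷ [ 2 ] ∷ (3 ∷ 4 ∷ [ 5 ]) ∷ (6 ∷ 7 ∷ 8 ∷ [ 9 ]) ∷ [])
    ∷ ([ 1 ] ∷ [ 2 ] ∷ (3 ∷ 4 ∷ [ 5 ]) ∷ (6 ∷ 7 ∷ 8 ∷ [ 9 ]) ∷ [])
    ∷ ([ 0 ] ∷ [ 1 ] ∷ [ 8 ] ∷ [ 9 ] ∷ [])
    ∷ ([ 0 ] ∷ [ 2 ] ∷ [ 8 ] ∷ [ 9 ] ∷ [])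
    ∷ ([ 1 ] ∷ [ 2 ] ∷ [ 8 ] ∷ [ 9 ] ∷ [])
    ∷ ([ 3 ] ∷ [ 4 ] ∷ [ 5 ] ∷ (8 ∷ [ 9 ]) ∷ [])
    ∷ ([ 6 ] ∷ [ 7 ] ∷ [ 8 ] ∷ [ 9 ] ∷ [])
    ∷ [])

open Blocks

-- Abstract, because unfolding the results of these searches exhausts memory.
abstract

  blocks₁-listsMIF : ListsMIF blocks₁ 4
  blocks₁-listsMIF = from-yes (listsMIF? blocks₁ 4)

  blocks₂-listsMIF : ListsMIF blocks₂ 4
  blocks₂-listsMIF = from-yes (listsMIF? blocks₂ 4)

  blocks₁-through-two : ∀ x y → Any (λ b → (x List.∈ b × y List.∈ b) ×
    Any (λ c → (x List.∈ c × y List.∈ c) × ¬ (b ∼[ set ] c)) blocks₁) blocks₁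
  blocks₁-through-two = from-yes (all? λ x → all? λ y →
    Any.any? (λ b → (x ∈? b ×-dec y ∈? b) ×-dec
      Any.any? (λ c → (x ∈? c ×-dec y ∈? c) ×-dec ¬? (b ∼? c)) blocks₁) blocks₁)

  -- Puts 6 and 7 in the point set, so that they have preimages under an isomorphism.
  blocks₂-cover : ∀ x → Any (x List.∈_) blocks₂
  blocks₂-cover = from-yes (all? λ x → Any.any? (x ∈?_) blocks₂)

  blocks₂-through-6-7 : All (λ b → # 6 List.∈ b × # 7 List.∈ b →
    b ∼[ set ] # 6 ∷ # 7 ∷ # 8 ∷ # 9 ∷ []) blocks₂
  blocks₂-through-6-7 =
    from-yes (All.all? (λ b → (# 6 ∈? b ×-dec # 7 ∈? b) →-dec
      (b ∼? # 6 ∷ # 7 ∷ # 8 ∷ # 9 ∷ [])) blocks₂)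

mainTheorem4 : Σ[ A ∈ Set ] Σ[ A′ ∈ Set ] Σ[ G ∈ Family A ] Σ[ H ∈ Family A′ ]
    ( IsMIF G 4 × HasBlockCount G 42
    × IsMIF H 4 × HasBlockCount H 42
    × ¬ Isomorphic G H )
mainTheorem4 = Point , Point , family blocks₁-listsMIF , family blocks₂-listsMIF ,
  family-isMIF blocks₁-listsMIF , family-blockCount blocks₁-listsMIF ,
  family-isMIF blocks₂-listsMIF , family-blockCount blocks₂-listsMIF ,
  λ iso → family-¬doublyJoined blocks₂-listsMIF blocks₂-through-6-7
    (allDoublyJoined⇒DoublyJoined iso
      (λ x y → family-doublyJoined blocks₁-listsMIF (blocks₁-through-two x y))
      (listed⇒inPointSet blocks₂-listsMIF (blocks₂-cover (# 6)))
      (listed⇒inPointSet blocks₂-listsMIF (blocks₂-cover (# 7))))
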